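{- The pure cactus group $PJ_4$ admits the one-relator presentation $PJ_4=\langle \alpha,\beta,\gamma,\delta,\epsilon \mid \alpha\gamma\epsilon\beta\epsilon\alpha^{ -1}\delta^{ -1}\beta\gamma\delta^{ -1}=1\rangle$, where, as elements of $J_4$, $\alpha=(s_{1,3}s_{1,2})^3$, $\beta=s_{1,2}s_{1,3}s_{1,4}s_{1,3}s_{1,4}s_{1,2}s_{1,4}$, $\gamma=s_{1,2}s_{1,4}s_{1,2}(s_{1,3}s_{1,4})^2$, $\delta=s_{1,3}(s_{1,2}s_{1,4})^2s_{1,3}s_{1,4}$, $\epsilon=(s_{1,4}s_{1,2}s_{1,3}s_{1,2})^2$.
   Context: For $n \ge 2$, the cactus group $J_n$ is the group with generators $s_{p,q}$ for $1 \le p < q \le n$ and relations: (j1) $s_{p,q}^2 = 1$; (j2) $s_{p,q}s_{m,r} = s_{m,r}s_{p,q}$ whenever $[p,q]\cap[m,r]=\emptyset$; (j3) $s_{p,q}s_{m,r} = s_{p+q-r,\,p+q-m}\,s_{p,q}$ whenever $[m,r]\subset[p,q]$. There is a homomorphism $s\colon J_n\to S_n$ sending $s_{p,q}$ to the permutation of $\{1,\dots,n\}$ that reverses the order of $p,p+1,\dots,q$ and fixes all other elements. The pure cactus group $PJ_n$ is the kernel of $s$. -}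

module Defs where

open import Data.Nat using (ℕ; zero; suc; _+_; _∸_; _≤_; _<_; _≤?_; _<?_)
open import Data.Bool using (Bool; true; false; not; if_then_else_)
open import Data.List using (List; []; _∷_; _++_; reverse; map; foldr)
open import Data.Product using (_×_; _,_; Σ; ∃)
open import Data.Unit using (⊤)
open import Data.Sum using (_⊎_)
open import Relation.Nullary.Decidable using (True; toWitness; ⌊_⌋)
open import Relation.Binary.PropositionalEquality using (_≡_)
open import Function using (_∘_; id)

-- Group presentations via words in the free group (setoid style).
-- A word is a list of letters (x , true) = x, (x , false) = x⁻¹.

Word : Set → Set
Word X = List (X × Bool)

gen : {X : Set} → X → Word X
gen x = (x , true) ∷ []

inv : {X : Set} → Word X → Word X
inv w = reverse (map (λ { (x , b) → (x , not b) }) w)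

data _⊢_≈_ {X : Set} (R : Word X → Set) : Word X → Word X → Set where
  ≈refl   : ∀ {u} → R ⊢ u ≈ u
  ≈sym    : ∀ {u v} → R ⊢ u ≈ v → R ⊢ v ≈ u
  ≈trans  : ∀ {u v w} → R ⊢ u ≈ v → R ⊢ v ≈ w → R ⊢ u ≈ w
  ≈cong   : ∀ {u u' v v'} → R ⊢ u ≈ u' → R ⊢ v ≈ v' → R ⊢ (u ++ v) ≈ (u' ++ v')
  ≈cancel : ∀ x b → R ⊢ ((x , b) ∷ (x , not b) ∷ []) ≈ []
  ≈rel    : ∀ {r} → R r → R ⊢ r ≈ []

subst : {X Y : Set} → (X → Word Y) → Word X → Word Y
subst f [] = []
subst f ((x , true) ∷ w) = f x ++ subst f w
subst f ((x , false) ∷ w) = inv (f x) ++ subst f w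

record JGen (n : ℕ) : Set where
  constructor sg
  field
    p q : ℕ
    1≤p : 1 ≤ p
    p<q : p < q
    q≤n : q ≤ n
open JGen public

-- relators of J_n (relation u = v encoded as relator u v⁻¹)
data JRel (n : ℕ) : Word (JGen n) → Set where
  j1 : (g : JGen n) → JRel n (gen g ++ gen g)
  j2 : (g h : JGen n) → (q g < p h) ⊎ (q h < p g) →
       JRel n (gen g ++ gen h ++ inv (gen g) ++ inv (gen h))
  j3 : (g h k : JGen n) → p g ≤ p h → q h ≤ q g →
       p k ≡ p g + q g ∸ q h → q k ≡ p g + q g ∸ p h →
       JRel n (gen g ++ gen h ++ inv (gen g) ++ inv (gen k))

s : {n : ℕ} (p q : ℕ) {a : True (1 ≤? p)} {b : True (p <? q)} {c : True (q ≤? n)} → Word (JGen n)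
s p q {a} {b} {c} = gen (sg p q (toWitness a) (toWitness b) (toWitness c))

-- The homomorphism s : J_n → S_n, as an action on {1,…,n} ⊂ ℕ.
-- s_{p,q} reverses p,…,q and fixes everything else.
reflect : ℕ → ℕ → ℕ → ℕ
reflect p q i = if ⌊ p ≤? i ⌋ then (if ⌊ i ≤? q ⌋ then p + q ∸ i else i) else i

-- each generator is an involution, so a letter and its inverse act the same
perm : {n : ℕ} → Word (JGen n) → ℕ → ℕ
perm [] = id
perm ((g , _) ∷ w) = reflect (p g) (q g) ∘ perm w

IsPure : (n : ℕ) → Word (JGen n) → Set
IsPure n w = ∀ i → 1 ≤ i → i ≤ n → perm w i ≡ i

_≈J_ : {n : ℕ} → Word (JGen n) → Word (JGen n) → Set
_≈J_ {n} u v = JRel n ⊢ u ≈ v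

data G5 : Set where
  α β γ δ ε : G5

relator : Word G5
relator = (α , true) ∷ (γ , true) ∷ (ε , true) ∷ (β , true) ∷ (ε , true) ∷
          (α , false) ∷ (δ , false) ∷ (β , true) ∷ (γ , true) ∷ (δ , false) ∷ []

data Rel5 : Word G5 → Set where
  the-relator : Rel5 relator

_≈G_ : Word G5 → Word G5 → Set
u ≈G v = Rel5 ⊢ u ≈ v

s12 s13 s14 : Word (JGen 4)
s12 = s 1 2
s13 = s 1 3
s14 = s 1 4

ι : G5 → Word (JGen 4)
ι α = s13 ++ s12 ++ s13 ++ s12 ++ s13 ++ s12
ι β = s12 ++ s13 ++ s14 ++ s13 ++ s14 ++ s12 ++ s14
ι γ = s12 ++ s14 ++ s12 ++ s13 ++ s14 ++ s13 ++ s14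
ι δ = s13 ++ s12 ++ s14 ++ s12 ++ s14 ++ s13 ++ s14
ι ε = s14 ++ s12 ++ s13 ++ s12 ++ s14 ++ s12 ++ s13 ++ s12

φ : Word G5 → Word (JGen 4)
φ = subst ι

{-# OPTIONS --safe #-}

-- Reidemeister–Schreier for the 24 cosets of PJ₄ in J₄ = ⟨a, b, c⟩ with
-- a = s₁₂, b = s₁₃, c = s₁₄.  Choose a transversal t and, for every generator g
-- and coset i, a word τ(g, i) in α, …, ε with g t(i) = t(g i) τ(g, i) in J₄.
-- Reading a word of J₄ through τ then expresses every pure element by α, …, ε.
-- Conversely τ kills every relator of J₄ at every coset and sends each of
-- ι α, …, ι ε back to its letter, so it induces an inverse of φ.  The finitely
-- many identities involved are word problems in J₄ and in the one-relator group;
-- both presentations are small-cancellation, so Dehn's algorithm settles them.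

module Submission where

open import Defs
open import Data.Product using (_×_; Σ)

open import Data.Bool using (Bool; true; false; not)
import Data.Bool.Properties as Bool
open import Data.Fin using (Fin; toℕ; #_)
import Data.Fin.Properties as Fin
open import Data.List using (List; []; _∷_; _++_; [_]; map; reverse; concatMap; take; drop; upTo; length)
open import Data.List.Properties using (++-assoc; ++-identityʳ; concatMap-++; take++drop≡id; unfold-reverse)
open import Data.Maybe using (Maybe; just; nothing)
open import Data.Nat using (ℕ; suc; _+_; _∸_; _≤_; _<_; _≤?_; _<?_; s≤s; z≤n; ⌊_/2⌋)
import Data.Nat.Properties as ℕ
open import Data.Product using (_,_; proj₁; proj₂; ∃-syntax)
import Data.Product.Properties as Product
open import Data.Sum using (_⊎_; inj₁)
open import Data.Vec using (Vec; []; _∷_; lookup)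
open import Function using (_∘_)
open import Level using (0ℓ)
open import Relation.Binary using (DecidableEquality; Setoid)
open import Relation.Binary.PropositionalEquality using (_≡_; refl; sym; trans; cong; cong₂) renaming (subst to transport)
import Relation.Binary.Reasoning.Setoid as SetoidReasoning
open import Relation.Nullary using (Dec; yes; no; _×-dec_; _⊎-dec_; _→-dec_)
open import Relation.Nullary.Decidable using (map′; from-yes)

-- Finite types

module Finite {A : Set} {n : ℕ} (enum : Fin n → A) (index : A → Fin n)
              (enum-index : ∀ x → enum (index x) ≡ x) where

  all? : {P : A → Set} → (∀ x → Dec (P x)) → Dec (∀ x → P x)
  all? {P} P? = map′ (λ f x → transport P (enum-index x) (f (index x))) (_∘ enum) (Fin.all? (P? ∘ enum))

  _≟_ : DecidableEquality A
  x ≟ y = map′ (λ e → trans (sym (enum-index x)) (trans (cong enum e) (enum-index y))) (cong index)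
               (index x Fin.≟ index y)

-- Presented groups

module Presented {X : Set} (R : Word X → Set) where

  infix 4 _≈_
  _≈_ : Word X → Word X → Set
  u ≈ v = R ⊢ u ≈ v

  ≈-reflexive : ∀ {u v} → u ≡ v → u ≈ v
  ≈-reflexive refl = ≈refl

  ≈-setoid : Setoid 0ℓ 0ℓ
  ≈-setoid = record
    { Carrier       = Word X
    ; _≈_           = _≈_
    ; isEquivalence = record { refl = ≈refl ; sym = ≈sym ; trans = ≈trans }
    }

  open SetoidReasoning ≈-setoid

  inv-∷ : ∀ (l : X × Bool) u → inv (l ∷ u) ≡ inv u ++ inv [ l ]
  -- The pattern lambda inside `inv` cannot be written again here; the helper abstracts over it and
  -- unification supplies it.
  inv-∷ = reverse-map-∷ _
    where
    reverse-map-∷ : ∀ (f : X × Bool → X × Bool) l u →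
                    reverse (map f (l ∷ u)) ≡ reverse (map f u) ++ [ f l ]
    reverse-map-∷ f l u = unfold-reverse (f l) (map f u)

  ++-inverseʳ : ∀ u → u ++ inv u ≈ []
  ++-inverseʳ []            = ≈refl
  ++-inverseʳ ((x , b) ∷ u) = begin
    (x , b) ∷ u ++ inv ((x , b) ∷ u)            ≡⟨ cong (λ v → (x , b) ∷ u ++ v) (inv-∷ (x , b) u) ⟩
    (x , b) ∷ u ++ inv u ++ [ (x , not b) ]     ≡⟨ cong ((x , b) ∷_) (++-assoc u (inv u) _) ⟨
    [ (x , b) ] ++ (u ++ inv u) ++ [ (x , not b) ]
      ≈⟨ ≈cong (≈refl {u = [ (x , b) ]}) (≈cong (++-inverseʳ u) ≈refl) ⟩
    (x , b) ∷ (x , not b) ∷ []                  ≈⟨ ≈cancel x b ⟩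
    []                                          ∎

  ++-inverseˡ : ∀ u → inv u ++ u ≈ []
  ++-inverseˡ []            = ≈refl
  ++-inverseˡ ((x , b) ∷ u) = begin
    inv ((x , b) ∷ u) ++ (x , b) ∷ u            ≡⟨ cong (_++ (x , b) ∷ u) (inv-∷ (x , b) u) ⟩
    (inv u ++ [ (x , not b) ]) ++ (x , b) ∷ u   ≡⟨ ++-assoc (inv u) _ _ ⟩
    inv u ++ ((x , not b) ∷ (x , b) ∷ []) ++ u
      ≡⟨ cong (λ b′ → inv u ++ ((x , not b) ∷ (x , b′) ∷ []) ++ u) (Bool.not-involutive b) ⟨
    inv u ++ ((x , not b) ∷ (x , not (not b)) ∷ []) ++ u
      ≈⟨ ≈cong (≈refl {u = inv u}) (≈cong (≈cancel x (not b)) ≈refl) ⟩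
    inv u ++ u                                  ≈⟨ ++-inverseˡ u ⟩
    []                                          ∎

  u++v≈[]⇒u≈v⁻¹ : ∀ u v → u ++ v ≈ [] → u ≈ inv v
  u++v≈[]⇒u≈v⁻¹ u v uv≈[] = begin
    u                   ≡⟨ ++-identityʳ u ⟨
    u ++ []             ≈⟨ ≈cong (≈refl {u = u}) (++-inverseʳ v) ⟨
    u ++ v ++ inv v     ≡⟨ ++-assoc u v (inv v) ⟨
    (u ++ v) ++ inv v   ≈⟨ ≈cong uv≈[] ≈refl ⟩
    inv v               ∎

  u++v⁻¹≈[]⇒u≈v : ∀ u v → u ++ inv v ≈ [] → u ≈ v
  u++v⁻¹≈[]⇒u≈v u v uv⁻¹≈[] = begin
    u                   ≡⟨ ++-identityʳ u ⟨
    u ++ []             ≈⟨ ≈cong (≈refl {u = u}) (++-inverseˡ v) ⟨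
    u ++ inv v ++ v     ≡⟨ ++-assoc u (inv v) v ⟨
    (u ++ inv v) ++ v   ≈⟨ ≈cong uv⁻¹≈[] ≈refl ⟩
    v                   ∎

  rotate-trivial : ∀ u v → u ++ v ≈ [] → v ++ u ≈ []
  rotate-trivial u v uv≈[] = begin
    v ++ u       ≈⟨ ≈cong (≈refl {u = v}) (u++v≈[]⇒u≈v⁻¹ u v uv≈[]) ⟩
    v ++ inv v   ≈⟨ ++-inverseʳ v ⟩
    []           ∎

  inv-trivial : ∀ {u} → u ≈ [] → inv u ≈ []
  inv-trivial {u} u≈[] = begin
    inv u        ≈⟨ ≈cong u≈[] ≈refl ⟨
    u ++ inv u   ≈⟨ ++-inverseʳ u ⟩
    []           ∎

-- Homomorphisms given on generators

module _ {X Y : Set} (f : X → Word Y) where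

  subst-++ : ∀ u v → subst f (u ++ v) ≡ subst f u ++ subst f v
  subst-++ []                v = refl
  subst-++ ((x , true) ∷ u)  v = trans (cong (f x ++_) (subst-++ u v)) (sym (++-assoc (f x) _ _))
  subst-++ ((x , false) ∷ u) v =
    trans (cong (inv (f x) ++_) (subst-++ u v)) (sym (++-assoc (inv (f x)) _ _))

  -- Von Dyck's theorem: only the relators have to be checked, since the other constructors of `≈`
  -- hold in every group.
  subst-resp-≈ : ∀ {R S} → (∀ {r} → R r → S ⊢ subst f r ≈ []) →
                 ∀ {u v} → R ⊢ u ≈ v → S ⊢ subst f u ≈ subst f v
  subst-resp-≈ {R} {S} rel = go
    where
    open Presented S

    go : ∀ {u v} → R ⊢ u ≈ v → subst f u ≈ subst f v
    go ≈refl        = ≈refl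
    go (≈sym e)     = ≈sym (go e)
    go (≈trans e d) = ≈trans (go e) (go d)
    go (≈cong {u} {u′} {v} {v′} e d) =
      ≈trans (≈-reflexive (subst-++ u v))
        (≈trans (≈cong (go e) (go d)) (≈-reflexive (sym (subst-++ u′ v′))))
    go (≈cancel x true)  =
      ≈trans (≈-reflexive (cong (f x ++_) (++-identityʳ (inv (f x))))) (++-inverseʳ (f x))
    go (≈cancel x false) =
      ≈trans (≈-reflexive (cong (inv (f x) ++_) (++-identityʳ (f x)))) (++-inverseˡ (f x))
    go (≈rel r)     = rel r

-- Dehn's algorithm

module Dehn {X : Set} (_≟_ : DecidableEquality X) (R : Word X → Set) where

  open Presented R
  open SetoidReasoning ≈-setoid

  -- Each rule carries its proof, so a reduced word equals the original one for any list of rules,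
  -- confluent or not.
  record Rule : Set where
    constructor _⇒_by_
    field
      lhs rhs : Word X
      sound   : lhs ≈ rhs

  stripPrefix : ∀ (l w : Word X) → Maybe (∃[ v ] w ≡ l ++ v)
  stripPrefix []      w       = just (w , refl)
  stripPrefix (_ ∷ _) []      = nothing
  stripPrefix (x ∷ l) (y ∷ w) with Product.≡-dec _≟_ Bool._≟_ x y
  ... | no _     = nothing
  ... | yes refl with stripPrefix l w
  ...   | nothing      = nothing
  ...   | just (v , e) = just (v , cong (x ∷_) e)

  rewriteHead : List Rule → ∀ w → Maybe (∃[ (r , v) ] w ≈ r ++ v)
  rewriteHead []                    w = nothing
  rewriteHead ((l ⇒ r by l≈r) ∷ rs) w with stripPrefix l w
  ... | just (v , e) = just ((r , v) , ≈trans (≈-reflexive e) (≈cong l≈r ≈refl))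
  ... | nothing      = rewriteHead rs w

  -- Prepend letters to a reduced word, reducing at the front; the first argument
  -- bounds the nesting of rewrites.
  mutual

    push : ℕ → List Rule → ∀ x w → ∃[ v ] x ∷ w ≈ v
    -- Out of fuel, the word is returned unreduced, which is still a correct answer.
    push 0       rs x w = x ∷ w , ≈refl
    push (suc n) rs x w with rewriteHead rs (x ∷ w)
    ... | nothing            = x ∷ w , ≈refl
    ... | just ((r , v) , e) with pushAll n rs r v
    ...   | v′ , e′ = v′ , ≈trans e e′

    pushAll : ℕ → List Rule → ∀ u w → ∃[ v ] u ++ w ≈ v
    pushAll n rs []      w = w , ≈refl
    pushAll n rs (x ∷ u) w with pushAll n rs u w
    ... | v , e with push n rs x v
    ...   | v′ , e′ = v′ , ≈trans (≈cong (≈refl {u = [ x ]}) e) e′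

  normalise : List Rule → ∀ w → ∃[ v ] w ++ [] ≈ v
  -- The bound limits nesting, not length; 100 suffices for every word checked below.
  normalise rs w = pushAll 100 rs w []

  nf : List Rule → Word X → Word X
  nf rs = proj₁ ∘ normalise rs

  ≈-nf : ∀ rs w → w ≈ nf rs w
  ≈-nf rs w = ≈trans (≈-reflexive (sym (++-identityʳ w))) (proj₂ (normalise rs w))

  Trivial : List Rule → Word X → Set
  Trivial rs w = nf rs w ≡ []

  trivial? : ∀ rs w → Dec (Trivial rs w)
  trivial? rs w with nf rs w
  ... | []    = yes refl
  ... | _ ∷ _ = no λ ()

  trivial⇒≈[] : ∀ {rs w} → Trivial rs w → w ≈ []
  trivial⇒≈[] {rs} {w} e = ≈trans (≈-nf rs w) (≈-reflexive e)

  trivial-quotient⇒≈ : ∀ {rs} u v → Trivial rs (u ++ inv v) → u ≈ v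
  trivial-quotient⇒≈ u v = u++v⁻¹≈[]⇒u≈v u v ∘ trivial⇒≈[]

  -- For each cyclic rotation of a relator, replace its longer half by the inverse
  -- of the shorter one.
  dehnRules : ∀ w → w ≈ [] → List Rule
  dehnRules w w≈[] = map rule (upTo (length w))
    where
    rule : ℕ → Rule
    rule i = take k u ⇒ inv (drop k u) by u++v≈[]⇒u≈v⁻¹ (take k u) (drop k u) halves≈[]
      where
      u = drop i w ++ take i w
      -- Strictly more than half, so that each rule shortens: length 10 splits as 6 and 4, length 8
      -- as 5 and 3.
      k = suc ⌊ length w /2⌋

      halves≈[] : take k u ++ drop k u ≈ []
      halves≈[] = begin
        take k u ++ drop k u   ≡⟨ take++drop≡id k u ⟩
        drop i w ++ take i w   ≈⟨ rotate-trivial (take i w) (drop i w)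
                                    (≈trans (≈-reflexive (take++drop≡id i w)) w≈[]) ⟩
        []                     ∎

  cancellation : X → Bool → Rule
  cancellation x b = ((x , b) ∷ (x , not b) ∷ []) ⇒ [] by ≈cancel x b

-- Words in the one-relator group

enumG : Fin 5 → G5
enumG = lookup (α ∷ β ∷ γ ∷ δ ∷ ε ∷ [])

indexG : G5 → Fin 5
indexG α = # 0
indexG β = # 1
indexG γ = # 2
indexG δ = # 3
indexG ε = # 4

enumG-indexG : ∀ x → enumG (indexG x) ≡ x
enumG-indexG α = refl
enumG-indexG β = refl
enumG-indexG γ = refl
enumG-indexG δ = refl
enumG-indexG ε = refl

module G5-finite = Finite enumG indexG enumG-indexG

module G where
  open Presented Rel5 public
  open Dehn G5-finite._≟_ Rel5 public

  -- Dehn's algorithm works with the symmetrised relators: all rotations of `relator` and of its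
  -- inverse.
  rules : List Rule
  rules = concatMap (λ x → cancellation x true ∷ cancellation x false ∷ []) (α ∷ β ∷ γ ∷ δ ∷ ε ∷ [])
       ++ dehnRules relator (≈rel the-relator)
       ++ dehnRules (inv relator) (inv-trivial (≈rel the-relator))

-- Words in J₄

enumJ : Fin 6 → JGen 4
enumJ = lookup (sg 1 2 1≤1+n (s≤s 1≤1+n) 2≤4 ∷ sg 1 3 1≤1+n (s≤s 1≤1+n) 3≤4 ∷
                sg 1 4 1≤1+n (s≤s 1≤1+n) 4≤4 ∷ sg 2 3 1≤1+n (s≤s (s≤s 1≤1+n)) 3≤4 ∷
                sg 2 4 1≤1+n (s≤s (s≤s 1≤1+n)) 4≤4 ∷ sg 3 4 1≤1+n (s≤s (s≤s (s≤s 1≤1+n))) 4≤4 ∷ [])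
  where
  1≤1+n : ∀ {n} → 1 ≤ suc n
  1≤1+n = s≤s z≤n
  2≤4 : 2 ≤ 4
  2≤4 = s≤s (s≤s z≤n)
  3≤4 : 3 ≤ 4
  3≤4 = s≤s (s≤s (s≤s z≤n))
  4≤4 : 4 ≤ 4
  4≤4 = s≤s (s≤s (s≤s (s≤s z≤n)))

indexJ : JGen 4 → Fin 6
indexJ (sg 1 2 _ _ _) = # 0
indexJ (sg 1 3 _ _ _) = # 1
indexJ (sg 1 4 _ _ _) = # 2
indexJ (sg 2 3 _ _ _) = # 3
indexJ (sg 2 4 _ _ _) = # 4
-- Among pairs with `1 ≤ p < q ≤ 4` only (3,4) is left, as `enumJ-indexJ` confirms.
indexJ _              = # 5

enumJ-indexJ : ∀ g → enumJ (indexJ g) ≡ g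
enumJ-indexJ (sg 1 2 (s≤s z≤n) (s≤s (s≤s z≤n)) (s≤s (s≤s z≤n))) = refl
enumJ-indexJ (sg 1 3 (s≤s z≤n) (s≤s (s≤s z≤n)) (s≤s (s≤s (s≤s z≤n)))) = refl
enumJ-indexJ (sg 1 4 (s≤s z≤n) (s≤s (s≤s z≤n)) (s≤s (s≤s (s≤s (s≤s z≤n))))) = refl
enumJ-indexJ (sg 2 3 (s≤s z≤n) (s≤s (s≤s (s≤s z≤n))) (s≤s (s≤s (s≤s z≤n)))) = refl
enumJ-indexJ (sg 2 4 (s≤s z≤n) (s≤s (s≤s (s≤s z≤n))) (s≤s (s≤s (s≤s (s≤s z≤n))))) = refl
enumJ-indexJ (sg 3 4 (s≤s z≤n) (s≤s (s≤s (s≤s (s≤s z≤n)))) (s≤s (s≤s (s≤s (s≤s z≤n))))) = refl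

module J-finite = Finite enumJ indexJ enumJ-indexJ

g12 g13 g14 g23 g24 g34 : JGen 4
g12 = enumJ (# 0)
g13 = enumJ (# 1)
g14 = enumJ (# 2)
g23 = enumJ (# 3)
g24 = enumJ (# 4)
g34 = enumJ (# 5)

s23 s24 s34 : Word (JGen 4)
s23 = s 2 3
s24 = s 2 4
s34 = s 3 4

module J where
  open Presented (JRel 4) public
  open Dehn J-finite._≟_ (JRel 4) public
  open SetoidReasoning ≈-setoid

  gen⁻¹≈gen : ∀ g → inv (gen g) ≈ gen g
  gen⁻¹≈gen g = ≈sym (u++v≈[]⇒u≈v⁻¹ (gen g) (gen g) (≈rel (j1 g)))

  conjugate : ∀ g h k → p g ≤ p h → q h ≤ q g → p k ≡ p g + q g ∸ q h → q k ≡ p g + q g ∸ p h →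
              gen k ≈ gen g ++ gen h ++ gen g
  conjugate g h k p≤ q≤ p≡ q≡ = begin
    gen k                             ≈⟨ u++v⁻¹≈[]⇒u≈v (gen g ++ gen h ++ inv (gen g)) (gen k) (≈rel (j3 g h k p≤ q≤ p≡ q≡)) ⟨
    gen g ++ gen h ++ inv (gen g)     ≈⟨ ≈cong (≈refl {u = gen g ++ gen h}) (gen⁻¹≈gen g) ⟩
    gen g ++ gen h ++ gen g           ∎

  positive : JGen 4 → Rule
  positive g = inv (gen g) ⇒ gen g by gen⁻¹≈gen g

  involution : JGen 4 → Rule
  involution g = (gen g ++ gen g) ⇒ [] by ≈rel (j1 g)

  generators : List (JGen 4)
  generators = g12 ∷ g13 ∷ g14 ∷ g23 ∷ g24 ∷ g34 ∷ []

  -- Tietze elimination: an interval not starting at 1 is the mirror image of one that does, so (j3)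
  -- makes its generator a conjugate. The remaining rules make words positive and remove squares.
  spellingRules : List Rule
  spellingRules =
    (s23 ⇒ (s13 ++ s12 ++ s13) by conjugate g13 g12 g23 1≤1 2≤3 refl refl) ∷
    (s24 ⇒ (s14 ++ s13 ++ s14) by conjugate g14 g13 g24 1≤1 3≤4 refl refl) ∷
    (s34 ⇒ (s14 ++ s12 ++ s14) by conjugate g14 g12 g34 1≤1 2≤4 refl refl) ∷
    map positive generators ++ map involution generators
    where
    1≤1 : 1 ≤ 1
    1≤1 = ℕ.≤-refl
    2≤3 : 2 ≤ 3
    2≤3 = ℕ.m≤n+m 2 1
    3≤4 : 3 ≤ 4
    3≤4 = ℕ.m≤n+m 3 1
    2≤4 : 2 ≤ 4
    2≤4 = ℕ.m≤n+m 2 2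

  -- The only disjoint pair of intervals is [1,2], [3,4]; its commutator becomes `(ac)⁴` once `s34`
  -- is spelled `cac`.
  [ac]⁴≈[] : s12 ++ s14 ++ s12 ++ s14 ++ s12 ++ s14 ++ s12 ++ s14 ≈ []
  [ac]⁴≈[] = ≈trans (≈sym (≈-nf spellingRules _)) (≈rel (j2 g12 g34 (inj₁ (s≤s (s≤s (s≤s z≤n))))))

  -- Reversing [1,4] carries [2,3] to itself, so `c` commutes with `s23`, spelled `bab`.
  [cbab]²≈[] : s14 ++ s13 ++ s12 ++ s13 ++ s14 ++ s13 ++ s12 ++ s13 ≈ []
  [cbab]²≈[] = ≈trans (≈sym (≈-nf spellingRules _))
                      (≈rel (j3 g14 g23 g23 (ℕ.m≤n+m 1 1) (ℕ.m≤n+m 3 1) refl refl))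

  rules : List Rule
  -- Up to signs, which `positive` removes, the inverses of both relators are rotations of them, so
  -- rotations suffice.
  rules = spellingRules ++ dehnRules _ [ac]⁴≈[] ++ dehnRules _ [cbab]²≈[]

-- The coset table

data Letter : Set where
  a b c : Letter

enumL : Fin 3 → Letter
enumL = lookup (a ∷ b ∷ c ∷ [])

indexL : Letter → Fin 3
indexL a = # 0
indexL b = # 1
indexL c = # 2

enumL-indexL : ∀ l → enumL (indexL l) ≡ l
enumL-indexL a = refl
enumL-indexL b = refl
enumL-indexL c = refl

module L-finite = Finite enumL indexL enumL-indexL

generator : Letter → Word (JGen 4)
generator a = s12
generator b = s13
generator c = s14

⟦_⟧ : List Letter → Word (JGen 4)
⟦_⟧ = concatMap generator

spellGen : JGen 4 → List Letter
spellGen = lookup ((a ∷ []) ∷ (b ∷ []) ∷ (c ∷ []) ∷ (b ∷ a ∷ b ∷ []) ∷ (c ∷ b ∷ c ∷ []) ∷ (c ∷ a ∷ c ∷ []) ∷ [])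
         ∘ indexJ

-- Signs are dropped, as the generators are involutions.
spell : Word (JGen 4) → List Letter
spell = concatMap (spellGen ∘ proj₁)

⟦spellGen⟧ : ∀ g → ⟦ spellGen g ⟧ J.≈ gen g
⟦spellGen⟧ g = J.trivial-quotient⇒≈ ⟦ spellGen g ⟧ (gen g) (checked g)
  where
  checked : ∀ g → J.Trivial J.rules (⟦ spellGen g ⟧ ++ inv (gen g))
  checked = from-yes (J-finite.all? λ g → J.trivial? J.rules (⟦ spellGen g ⟧ ++ inv (gen g)))

⟦spell⟧ : ∀ w → ⟦ spell w ⟧ J.≈ w
⟦spell⟧ []            = ≈refl
⟦spell⟧ ((g , s) ∷ w) = begin
  ⟦ spellGen g ++ spell w ⟧       ≡⟨ concatMap-++ generator (spellGen g) (spell w) ⟩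
  ⟦ spellGen g ⟧ ++ ⟦ spell w ⟧   ≈⟨ ≈cong (⟦spellGen⟧ g) (⟦spell⟧ w) ⟩
  gen g ++ w                      ≈⟨ ≈cong (sign s) ≈refl ⟩
  (g , s) ∷ w                     ∎
  where
  open SetoidReasoning J.≈-setoid

  sign : ∀ s → gen g J.≈ [ (g , s) ]
  sign true  = ≈refl
  sign false = ≈sym (J.gen⁻¹≈gen g)

Coset : Set
Coset = Fin 24

record Row : Set where
  constructor row
  field
    rep               : List Letter
    via-a via-b via-c : Coset × Word G5

  via : Letter → Coset × Word G5
  via a = via-a
  via b = via-b
  via c = via-c

α⁺ α⁻ β⁺ β⁻ γ⁺ γ⁻ δ⁺ δ⁻ ε⁺ ε⁻ : G5 × Bool
α⁺ = α , true
α⁻ = α , false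
β⁺ = β , true
β⁻ = β , false
γ⁺ = γ , true
γ⁻ = γ , false
δ⁺ = δ , true
δ⁻ = δ , false
ε⁺ = ε , true
ε⁻ = ε , false

-- Row i holds t(i) and, for each letter g, the pair (g i , τ(g, i)).  The t(i)
-- form a Schreier tree, along which τ is empty.
cosets : Vec Row 24
cosets =
  row ([]) (# 1 , []) (# 2 , []) (# 3 , []) ∷
  row (a ∷ []) (# 0 , []) (# 5 , []) (# 7 , []) ∷
  row (b ∷ []) (# 20 , α⁻ ∷ []) (# 0 , []) (# 8 , []) ∷
  row (c ∷ []) (# 4 , []) (# 6 , []) (# 0 , []) ∷
  row (a ∷ c ∷ []) (# 3 , []) (# 12 , []) (# 14 , []) ∷
  row (b ∷ a ∷ []) (# 9 , []) (# 1 , []) (# 15 , []) ∷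
  row (b ∷ c ∷ []) (# 10 , []) (# 3 , []) (# 16 , []) ∷
  row (c ∷ a ∷ []) (# 11 , []) (# 13 , []) (# 1 , []) ∷
  row (c ∷ b ∷ []) (# 22 , δ⁻ ∷ []) (# 18 , β⁻ ∷ []) (# 2 , []) ∷
  row (a ∷ b ∷ a ∷ []) (# 5 , []) (# 20 , []) (# 21 , []) ∷
  row (a ∷ b ∷ c ∷ []) (# 6 , []) (# 21 , α⁻ ∷ []) (# 22 , []) ∷
  row (a ∷ c ∷ a ∷ []) (# 7 , []) (# 16 , γ⁻ ∷ []) (# 18 , []) ∷
  row (b ∷ a ∷ c ∷ []) (# 21 , ε⁻ ∷ []) (# 4 , []) (# 13 , γ⁺ ∷ []) ∷
  row (b ∷ c ∷ a ∷ []) (# 17 , []) (# 7 , []) (# 12 , γ⁻ ∷ []) ∷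
  row (c ∷ a ∷ c ∷ []) (# 18 , []) (# 15 , β⁺ ∷ []) (# 4 , []) ∷
  row (c ∷ b ∷ a ∷ []) (# 19 , []) (# 14 , β⁻ ∷ []) (# 5 , []) ∷
  row (c ∷ b ∷ c ∷ []) (# 23 , α⁻ ∷ δ⁺ ∷ []) (# 11 , γ⁺ ∷ []) (# 6 , []) ∷
  row (a ∷ b ∷ c ∷ a ∷ []) (# 13 , []) (# 23 , []) (# 19 , ε⁻ ∷ γ⁻ ∷ []) ∷
  row (a ∷ c ∷ a ∷ c ∷ []) (# 14 , []) (# 8 , β⁺ ∷ []) (# 11 , []) ∷
  row (a ∷ c ∷ b ∷ a ∷ []) (# 15 , []) (# 22 , α⁺ ∷ ε⁻ ∷ β⁻ ∷ []) (# 17 , γ⁺ ∷ ε⁺ ∷ []) ∷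
  row (b ∷ a ∷ b ∷ a ∷ []) (# 2 , α⁺ ∷ []) (# 9 , []) (# 23 , []) ∷
  row (c ∷ a ∷ b ∷ a ∷ []) (# 12 , ε⁺ ∷ []) (# 10 , α⁺ ∷ []) (# 9 , []) ∷
  row (c ∷ a ∷ b ∷ c ∷ []) (# 8 , δ⁺ ∷ []) (# 19 , β⁺ ∷ ε⁺ ∷ α⁻ ∷ []) (# 10 , []) ∷
  row (c ∷ b ∷ a ∷ b ∷ a ∷ []) (# 16 , δ⁻ ∷ α⁺ ∷ []) (# 17 , []) (# 20 , []) ∷ []

transversal : Coset → Word (JGen 4)
transversal i = ⟦ Row.rep (lookup cosets i) ⟧

step : Letter → Coset → Coset
step l i = proj₁ (Row.via (lookup cosets i) l)

τ : Letter → Coset → Word G5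
τ l i = proj₂ (Row.via (lookup cosets i) l)

run : List Letter → Coset → Coset
run []      i = i
run (l ∷ w) i = step l (run w i)

τ* : List Letter → Coset → Word G5
τ* []      i = []
τ* (l ∷ w) i = τ l (run w i) ++ τ* w i

run-++ : ∀ u v i → run (u ++ v) i ≡ run u (run v i)
run-++ []      v i = refl
run-++ (l ∷ u) v i = cong (step l) (run-++ u v i)

-- The cocycle identity of the rewriting: `v` acts first, since the group acts on left cosets.
τ*-++ : ∀ u v i → τ* (u ++ v) i ≡ τ* u (run v i) ++ τ* v i
τ*-++ []      v i = refl
τ*-++ (l ∷ u) v i =
  trans (cong₂ (λ j w → τ l j ++ w) (run-++ u v i) (τ*-++ u v i))
        (sym (++-assoc (τ l (run u (run v i))) _ _))

spell-++ : ∀ u v → spell (u ++ v) ≡ spell u ++ spell v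
spell-++ = concatMap-++ (spellGen ∘ proj₁)

-- Rewriting is sound

-- The 72 Schreier identities behind the table. For instance `ab = baba (ba)⁻³` explains the entry
-- `α⁻` in the row of `b`.
step-sound : ∀ l i → generator l ++ transversal i J.≈ transversal (step l i) ++ φ (τ l i)
step-sound l i = J.trivial-quotient⇒≈ _ _ (checked l i)
  where
  quotient : Letter → Coset → Word (JGen 4)
  quotient l i = (generator l ++ transversal i) ++ inv (transversal (step l i) ++ φ (τ l i))

  checked : ∀ l i → J.Trivial J.rules (quotient l i)
  checked = from-yes (L-finite.all? λ l → Fin.all? λ i → J.trivial? J.rules (quotient l i))

run-sound : ∀ w i → ⟦ w ⟧ ++ transversal i J.≈ transversal (run w i) ++ φ (τ* w i)
run-sound []      i = J.≈-reflexive (sym (++-identityʳ (transversal i)))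
run-sound (l ∷ w) i = begin
  (generator l ++ ⟦ w ⟧) ++ transversal i             ≡⟨ ++-assoc (generator l) ⟦ w ⟧ _ ⟩
  generator l ++ ⟦ w ⟧ ++ transversal i               ≈⟨ ≈cong (≈refl {u = generator l}) (run-sound w i) ⟩
  generator l ++ transversal j ++ φ (τ* w i)          ≡⟨ ++-assoc (generator l) (transversal j) _ ⟨
  (generator l ++ transversal j) ++ φ (τ* w i)        ≈⟨ ≈cong (step-sound l j) ≈refl ⟩
  (transversal (step l j) ++ φ (τ l j)) ++ φ (τ* w i) ≡⟨ ++-assoc (transversal (step l j)) _ _ ⟩
  transversal (step l j) ++ φ (τ l j) ++ φ (τ* w i)   ≡⟨ cong (transversal (step l j) ++_) (subst-++ ι (τ l j) (τ* w i)) ⟨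
  transversal (step l j) ++ φ (τ l j ++ τ* w i)       ∎
  where
  open SetoidReasoning J.≈-setoid
  j = run w i

-- Rewriting is well defined on J₄

-- Inside a word a relator is read from whichever coset the letters to its right have reached, hence
-- the condition at every `i`.
Killed : List Letter → Set
Killed w = ∀ i → run w i ≡ i × G.Trivial G.rules (τ* w i)

killed? : ∀ w → Dec (Killed w)
killed? w = Fin.all? λ i → (run w i Fin.≟ i) ×-dec G.trivial? G.rules (τ* w i)

j1-killed : ∀ g → Killed (spell (gen g ++ gen g))
j1-killed = from-yes (J-finite.all? λ g → killed? (spell (gen g ++ gen g)))

j2-killed : ∀ g h → (q g < p h) ⊎ (q h < p g) → Killed (spell (gen g ++ gen h ++ inv (gen g) ++ inv (gen h)))
j2-killed = from-yes (J-finite.all? λ g → J-finite.all? λ h →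
  ((q g <? p h) ⊎-dec (q h <? p g)) →-dec
  killed? (spell (gen g ++ gen h ++ inv (gen g) ++ inv (gen h))))

-- A search over all 216 triples; deciding the side conditions along with the conclusion avoids
-- listing the valid ones.
j3-killed : ∀ g h k → p g ≤ p h → q h ≤ q g → p k ≡ p g + q g ∸ q h → q k ≡ p g + q g ∸ p h →
            Killed (spell (gen g ++ gen h ++ inv (gen g) ++ inv (gen k)))
j3-killed = from-yes (J-finite.all? λ g → J-finite.all? λ h → J-finite.all? λ k →
  (p g ≤? p h) →-dec (q h ≤? q g) →-dec
  (p k ℕ.≟ p g + q g ∸ q h) →-dec (q k ℕ.≟ p g + q g ∸ p h) →-dec
  killed? (spell (gen g ++ gen h ++ inv (gen g) ++ inv (gen k))))

relator-killed : ∀ {r} → JRel 4 r → Killed (spell r)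
relator-killed (j1 g)                   = j1-killed g
relator-killed (j2 g h disjoint)        = j2-killed g h disjoint
relator-killed (j3 g h k p≤ q≤ p≡ q≡)   = j3-killed g h k p≤ q≤ p≡ q≡

SameRun : List Letter → List Letter → Set
SameRun u v = ∀ i → run u i ≡ run v i × τ* u i G.≈ τ* v i

killed⇒sameRun : ∀ w → Killed w → SameRun w []
killed⇒sameRun w kill i = proj₁ (kill i) , G.trivial⇒≈[] {G.rules} (proj₂ (kill i))

-- The right factors lead to the same coset, so the left factors are compared there by the cocycle
-- identity.
sameRun-++ : ∀ {u u′ v v′} → SameRun u u′ → SameRun v v′ → SameRun (u ++ v) (u′ ++ v′)
sameRun-++ {u} {u′} {v} {v′} r r′ i
  rewrite run-++ u v i | run-++ u′ v′ i | τ*-++ u v i | τ*-++ u′ v′ i | proj₁ (r′ i)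
  = proj₁ (r (run v′ i)) , ≈cong (proj₂ (r (run v′ i))) (proj₂ (r′ i))

sameRun-resp-≈ : ∀ {u v} → u ≈J v → SameRun (spell u) (spell v)
sameRun-resp-≈ ≈refl         i = refl , ≈refl
sameRun-resp-≈ (≈sym e)      i with sameRun-resp-≈ e i
... | r , t = sym r , ≈sym t
sameRun-resp-≈ (≈trans e e′) i with sameRun-resp-≈ e i | sameRun-resp-≈ e′ i
... | r , t | r′ , t′ = trans r r′ , ≈trans t t′
sameRun-resp-≈ (≈cong {u} {u′} {v} {v′} e e′) i
  rewrite spell-++ u v | spell-++ u′ v′
  = sameRun-++ {spell u} {spell u′} (sameRun-resp-≈ e) (sameRun-resp-≈ e′) i
-- As `spell` drops signs, a cancelling pair is spelled like the square in (j1).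
sameRun-resp-≈ (≈cancel g s) i = killed⇒sameRun (spell (gen g ++ gen g)) (j1-killed g) i
sameRun-resp-≈ (≈rel {w} r)  i = killed⇒sameRun (spell w) (relator-killed r) i

-- Rewriting inverts φ

base : Coset
base = # 0

-- Treats both signs alike, so that `φ` unfolds without a case split.
φ-letter : G5 → Bool → Word (JGen 4)
φ-letter x true  = ι x
φ-letter x false = inv (ι x)

φ-∷ : ∀ x s u → φ ((x , s) ∷ u) ≡ φ-letter x s ++ φ u
φ-∷ x true  u = refl
φ-∷ x false u = refl

all-letters? : {P : G5 → Bool → Set} → (∀ x s → Dec (P x s)) → Dec (∀ x s → P x s)
all-letters? P? = G5-finite.all? λ x →
  map′ (λ { (t , f) true → t ; (t , f) false → f }) (λ f → f true , f false)
       (P? x true ×-dec P? x false)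

τ*-letter : ∀ x s → run (spell (φ-letter x s)) base ≡ base ×
                    G.Trivial G.rules (τ* (spell (φ-letter x s)) base ++ inv [ (x , s) ])
τ*-letter = from-yes (all-letters? λ x s →
  (run (spell (φ-letter x s)) base Fin.≟ base) ×-dec
  G.trivial? G.rules (τ* (spell (φ-letter x s)) base ++ inv [ (x , s) ]))

-- Each letter's image loops at `base` and reads back as that letter, so by the cocycle identity the
-- readings simply concatenate.
τ*-inverts-φ : ∀ u → run (spell (φ u)) base ≡ base × τ* (spell (φ u)) base G.≈ u
τ*-inverts-φ []            = refl , ≈refl
τ*-inverts-φ ((x , s) ∷ u)
  rewrite φ-∷ x s u | spell-++ (φ-letter x s) (φ u)
        | run-++ (spell (φ-letter x s)) (spell (φ u)) base
        | τ*-++ (spell (φ-letter x s)) (spell (φ u)) base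
        | proj₁ (τ*-inverts-φ u)
  = proj₁ (τ*-letter x s)
  , ≈cong (G.trivial-quotient⇒≈ _ [ (x , s) ] (proj₂ (τ*-letter x s))) (proj₂ (τ*-inverts-φ u))

φ-injective : ∀ u v → φ u ≈J φ v → u ≈G v
φ-injective u v e = begin
  u                       ≈⟨ proj₂ (τ*-inverts-φ u) ⟨
  τ* (spell (φ u)) base   ≈⟨ proj₂ (sameRun-resp-≈ e base) ⟩
  τ* (spell (φ v)) base   ≈⟨ proj₂ (τ*-inverts-φ v) ⟩
  v                       ∎
  where open SetoidReasoning G.≈-setoid

-- Pure words

-- The shift matches the points 1 to 4; quantifying over `Fin 4` makes purity decidable.
point : Fin 4 → ℕ
point = suc ∘ toℕ

onPoints⇒isPure : ∀ w → (∀ i → perm w (point i) ≡ point i) → IsPure 4 w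
onPoints⇒isPure w fixed 1 _ _ = fixed (# 0)
onPoints⇒isPure w fixed 2 _ _ = fixed (# 1)
onPoints⇒isPure w fixed 3 _ _ = fixed (# 2)
onPoints⇒isPure w fixed 4 _ _ = fixed (# 3)
onPoints⇒isPure w fixed (suc (suc (suc (suc (suc _))))) _ (s≤s (s≤s (s≤s (s≤s ()))))

isPure⇒onPoints : ∀ w → IsPure 4 w → ∀ i → perm w (point i) ≡ point i
isPure⇒onPoints w pure i = pure (point i) (s≤s z≤n) (Fin.toℕ<n i)

perm-++ : ∀ {n} (u v : Word (JGen n)) i → perm (u ++ v) i ≡ perm u (perm v i)
perm-++ []            v i = refl
perm-++ ((g , _) ∷ u) v i = cong (reflect (p g) (q g)) (perm-++ u v i)

φ-letter-pure : ∀ x s i → perm (φ-letter x s) (point i) ≡ point i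
φ-letter-pure = from-yes (all-letters? λ x s → Fin.all? λ i → perm (φ-letter x s) (point i) ℕ.≟ point i)

φ-fixes-points : ∀ u i → perm (φ u) (point i) ≡ point i
φ-fixes-points []            i = refl
φ-fixes-points ((x , s) ∷ u) i
  rewrite φ-∷ x s u | perm-++ (φ-letter x s) (φ u) (point i) | φ-fixes-points u i
  = φ-letter-pure x s i

-- The coset table models left multiplication in the symmetric group; checking it on generators
-- suffices.
perm-transversal-step : ∀ g i k → perm (transversal (run (spellGen g) i)) (point k)
                                ≡ reflect (p g) (q g) (perm (transversal i) (point k))
perm-transversal-step = from-yes (J-finite.all? λ g → Fin.all? λ i → Fin.all? λ k →
  perm (transversal (run (spellGen g) i)) (point k) ℕ.≟ reflect (p g) (q g) (perm (transversal i) (point k)))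

perm-transversal-run : ∀ w k → perm (transversal (run (spell w) base)) (point k) ≡ perm w (point k)
perm-transversal-run []            k = refl
perm-transversal-run ((g , _) ∷ w) k
  rewrite run-++ (spellGen g) (spell w) base
  = trans (perm-transversal-step g (run (spell w) base) k)
          (cong (reflect (p g) (q g)) (perm-transversal-run w k))

-- Of the 24 representatives only the empty one acts as the identity.
pure-coset : ∀ i → (∀ k → perm (transversal i) (point k) ≡ point k) → i ≡ base
pure-coset = from-yes (Fin.all? λ i →
  Fin.all? (λ k → perm (transversal i) (point k) ℕ.≟ point k) →-dec (i Fin.≟ base))

-- Soundness at `base`, where the representative is empty, factors `w` as a representative times
-- `φ (τ* (spell w) base)`. Purity forces that representative to be empty too.
φ-surjective : ∀ w → IsPure 4 w → Σ (Word G5) (λ u → φ u ≈J w)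
φ-surjective w pure = τ* (spell w) base , (begin
  φ (τ* (spell w) base)                                    ≡⟨ cong (λ i → transversal i ++ φ (τ* (spell w) base)) w-returns ⟨
  transversal (run (spell w) base) ++ φ (τ* (spell w) base) ≈⟨ run-sound (spell w) base ⟨
  ⟦ spell w ⟧ ++ []                                        ≡⟨ ++-identityʳ _ ⟩
  ⟦ spell w ⟧                                              ≈⟨ ⟦spell⟧ w ⟩
  w                                                        ∎)
  where
  open SetoidReasoning J.≈-setoid

  w-returns : run (spell w) base ≡ base
  w-returns = pure-coset (run (spell w) base)
    λ k → trans (perm-transversal-run w k) (isPure⇒onPoints w pure k)

-- The image is a word of 70 letters, which Dehn's algorithm reduces to the empty word.
φ-relator : ∀ {r} → Rel5 r → φ r ≈J []
φ-relator the-relator = J.trivial⇒≈[] {J.rules} refl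

theoremA3 : (∀ u v → u ≈G v → φ u ≈J φ v)
    × (∀ u → IsPure 4 (φ u))
    × (∀ u v → φ u ≈J φ v → u ≈G v)
    × (∀ w → IsPure 4 w → Σ (Word G5) (λ u → φ u ≈J w))
theoremA3 = (λ u v → subst-resp-≈ ι φ-relator)
          , (λ u → onPoints⇒isPure (φ u) (φ-fixes-points u))
          , φ-injective
          , φ-surjective
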